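{- Let $\mathcal F=\{f:N\to N\mid f\text{ is recursive}\}$ be the set of (total) recursive functions from $N$ to $N$, and let $\mathcal G=\{\widehat f\mid f:X\to Y\in\mathfrak D_N\}$ be the set of distributively computable functions over the basic functions $s:I+N\to N$ and $p:N\to I+N$ whose domains and codomains have been coded in $N$, where $\widehat f=\sigma_Y\circ f\circ\sigma'_X:N\to N$. Then $\mathcal F=\mathcal G$.
   Context: $N=\{0,1,2,\dots\}$, $I=\{*\}$ is a one-element set, $X+Y$ is the disjoint union (elements $\langle x,0\rangle$, $\langle y,1\rangle$; tags are omitted when no confusion is possible), and $X\times Y$ is the cartesian product. Recursive functions: the smallest set of functions $N^k\to N$ containing the constant zero function, the successor and the projections, and closed under (i) substitution: from $f:N^k\to N$ and $g_i:N^j\to N$ form $f(g_1,\dots,g_k)$; (ii) primitive recursion: from $g:N^k\to N$, $h:N^{k+2}\to N$ form $f$ with $f(\underline m,0)=g(\underline m)$, $f(\underline m,n+1)=h(\underline m,n,f(\underline m,n))$; (iii) minimization: from $f:N^{k+1}\to N$ such that for all $\underline m$ there is $n_{\underline m}$ with $f(\underline m,n_{\underline m})=0$, form $g(\underline m)=\min\{n\mid f(\underline m,n)=0\}$. Distributive computability. Given basic sets and basic functions, the derived sets are those obtained from the basic sets, $\varnothing$ and $I$ by repeated use of $+$ and $\times$; basic functions go between derived sets. The derived functions are those obtained from the basic functions, injections $\mathrm{inj}_i$ into binary sums, projections $\mathrm{proj}_i$ from binary products, identities, initial maps $\varnothing\to X$, terminal maps $X\to I$, and the inverse distributivity isomorphisms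 $\delta^{ -1}:X\times(Y+Z)\to X\times Y+X\times Z$, by repeated use of composition, $(f\mid g):X+Y\to Z$ (equal to $f:X\to Z$ on $X$ and to $g:Y\to Z$ on $Y$) and $(f,g):Z\to X\times Y$, $z\mapsto\langle f(z),g(z)\rangle$. If $X,U,Y$ are derived sets and $f:X+U\to U+Y$ is a derived function such that for each $x\in X$ there is $n_x$ with $f^{n_x}(x)\in Y$ (start from $x$, apply $f$, and keep re-applying $f$ as long as the value is in $U$), then $\mathbf{call}[f]:X\to Y$ is $x\mapsto f^{n_x}(x)$. The distributively computable functions are exactly the functions of the form $\mathbf{call}[f]$ with $f$ derived. $\mathfrak D_N$ is the class of distributively computable functions with unique basic set $N$ and basic functions $p:N\to I+N$, $p(0)=*$, $p(n)=n-1$ for $n>0$, and $s:I+N\to N$, $s(*)=0$, $s(n)=n+1$. Encodings. $\sigma_+:N+N\to N$, $\sigma_+(\langle n,k\rangle)=2n+k$, and $\sigma_\times:N\times N\to N$ is the standard (e.g. Cantor) bijective pairing function. For each derived set $X$ built from $N$ and $I$, the maps $\sigma_X:X\to N$ and $\sigma'_X:N\to X$ are defined inductively: $\sigma_I(*)=0$ and $\sigma'_I$ is the unique map $N\to I$; $\sigma_N=\sigma'_N=\mathbf 1_N$; $\sigma_{Y+Z}=\sigma_+\circ(\sigma_Y+\sigma_Z)$, $\sigma'_{Y+Z}=(\sigma'_Y+\sigma'_Z)\circ\sigma_+^{ -1}$; $\sigma_{Y\times Z}=\sigma_\times\circ(\sigma_Y\times\sigma_Z)$, $\sigma'_{Y\times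 Z}=(\sigma'_Y\times\sigma'_Z)\circ\sigma_\times^{ -1}$. In the definition of $\mathcal G$, $X$ and $Y$ range over the derived sets built from $N$ and $I$ only (no occurrence of $\varnothing$). -}

module Defs where

open import Data.Empty using (⊥; ⊥-elim)
open import Data.Fin using (Fin)
open import Data.Nat using (ℕ; zero; suc; _+_; _*_; _/_; _≤_)
open import Data.Nat.Divisibility using (divides-refl)
open import Data.Nat.DivMod using (+-distrib-/-∣ʳ; m*n/n≡m)
open import Data.Nat.Properties using (+-suc; +-identityʳ; suc-injective)
open import Data.Nat.Tactic.RingSolver using (solve-∀)
open import Data.Product using (_×_; _,_; proj₁; proj₂; ∃₂; ∃-syntax; <_,_>)
  renaming (map to map×)
open import Data.Sum using (_⊎_; inj₁; inj₂; [_,_]′) renaming (map to map⊎)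
open import Data.Unit using (⊤; tt)
open import Data.Vec using (Vec; head; lookup; tabulate; _∷ʳ_)
open import Function using (_∘_; id; const; _↔_; mk↔ₛ′; Inverse)
open import Relation.Binary.PropositionalEquality
  using (_≡_; refl; sym; trans; cong; _≗_; module ≡-Reasoning)
open import Relation.Unary using (Pred)
open import Level using (0ℓ)

IsLeast : Pred ℕ 0ℓ → ℕ → Set
IsLeast P n = P n × (∀ k → P k → n ≤ k)

-- Classes of functions are predicates.  Functions are identified up to `_≗_`,
-- so each class gets a closure rule `resp`; without funext it is not automatic.
data Recursive : ∀ {k} → (Vec ℕ k → ℕ) → Set where
  zeroᶠ    : ∀ {k} → Recursive {k} (const 0)
  sucᶠ     : Recursive {1} (suc ∘ head)
  projᶠ    : ∀ {k} (i : Fin k) → Recursive (λ m → lookup m i)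
  substᶠ   : ∀ {k j} {f : Vec ℕ k → ℕ} {g : Fin k → Vec ℕ j → ℕ} →
             Recursive f → (∀ i → Recursive (g i)) →
             Recursive (λ m → f (tabulate (λ i → g i m)))
  primRec  : ∀ {k} {g : Vec ℕ k → ℕ} {h : Vec ℕ (suc (suc k)) → ℕ}
             {f : Vec ℕ (suc k) → ℕ} →
             Recursive g → Recursive h →
             (∀ m → f (m ∷ʳ 0) ≡ g m) →
             (∀ m n → f (m ∷ʳ suc n) ≡ h (m ∷ʳ n ∷ʳ f (m ∷ʳ n))) →
             Recursive f
  minimize : ∀ {k} {f : Vec ℕ (suc k) → ℕ} {g : Vec ℕ k → ℕ} →
             Recursive f →
             (∀ m → ∃[ n ] f (m ∷ʳ n) ≡ 0) →
             (∀ m → IsLeast (λ n → f (m ∷ʳ n) ≡ 0) (g m)) →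
             Recursive g
  resp     : ∀ {k} {f g : Vec ℕ k → ℕ} → f ≗ g → Recursive f → Recursive g

infixr 6 _⊕_
infixr 7 _⊗_

data DSet (B : Set) : Set where
  base    : B → DSet B
  ∅ I     : DSet B
  _⊕_ _⊗_ : DSet B → DSet B → DSet B

El : {B : Set} → (B → Set) → DSet B → Set
El E (base b) = E b
El E ∅        = ⊥
El E I        = ⊤
El E (X ⊕ Y)  = El E X ⊎ El E Y
El E (X ⊗ Y)  = El E X × El E Y

δ⁻¹ : {A B C : Set} → A × (B ⊎ C) → (A × B) ⊎ (A × C)
δ⁻¹ (a , inj₁ b) = inj₁ (a , b)
δ⁻¹ (a , inj₂ c) = inj₂ (a , c)

-- `Iterate f x n z` says that fⁿ(x) is defined and equal to z.  It is
-- undefined for n = 0, and once a value in Y has been reached there are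
-- no further iterates.
data Iterate {X U Y : Set} (f : X ⊎ U → U ⊎ Y) (x : X) : ℕ → U ⊎ Y → Set where
  first : Iterate f x 1 (f (inj₁ x))
  again : ∀ {n u} → Iterate f x n (inj₁ u) → Iterate f x (suc n) (f (inj₂ u))

Terminating : {X U Y : Set} → (X ⊎ U → U ⊎ Y) → Set
Terminating f = ∀ x → ∃[ n ] ∃[ y ] Iterate f x n (inj₂ y)

call : {X U Y : Set} (f : X ⊎ U → U ⊎ Y) → Terminating f → X → Y
call f t x = proj₁ (proj₂ (t x))

module Distributive {B : Set} (E : B → Set)
  (Basic : (X Y : DSet B) → (El E X → El E Y) → Set) where

  data Derived : (X Y : DSet B) → (El E X → El E Y) → Set where
    basic    : ∀ {X Y f} → Basic X Y f → Derived X Y f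
    injˡ     : ∀ {X Y} → Derived X (X ⊕ Y) inj₁
    injʳ     : ∀ {X Y} → Derived Y (X ⊕ Y) inj₂
    projˡ    : ∀ {X Y} → Derived (X ⊗ Y) X proj₁
    projʳ    : ∀ {X Y} → Derived (X ⊗ Y) Y proj₂
    identity : ∀ {X} → Derived X X id
    initial  : ∀ {X} → Derived ∅ X ⊥-elim
    terminal : ∀ {X} → Derived X I (const tt)
    distrib  : ∀ {X Y Z} → Derived (X ⊗ (Y ⊕ Z)) (X ⊗ Y ⊕ X ⊗ Z) δ⁻¹
    compose  : ∀ {X Y Z f g} → Derived Y Z g → Derived X Y f →
               Derived X Z (g ∘ f)
    copair   : ∀ {X Y Z f g} → Derived X Z f → Derived Y Z g →
               Derived (X ⊕ Y) Z [ f , g ]′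
    pair     : ∀ {X Y Z f g} → Derived Z X f → Derived Z Y g →
               Derived Z (X ⊗ Y) < f , g >
    resp     : ∀ {X Y f g} → f ≗ g → Derived X Y f → Derived X Y g

  DistributivelyComputable : (X Y : DSet B) → (El E X → El E Y) → Set
  DistributivelyComputable X Y g =
    ∃[ U ] ∃[ f ] Derived (X ⊕ U) (U ⊕ Y) f ×
      (∃[ t ] g ≗ call {El E X} {El E U} {El E Y} f t)

⟦_⟧ : DSet ⊤ → Set
⟦_⟧ = El (const ℕ)

pattern N = base tt

p : ℕ → ⊤ ⊎ ℕ
p zero    = inj₁ tt
p (suc n) = inj₂ n

s : ⊤ ⊎ ℕ → ℕ
s (inj₁ tt) = 0
s (inj₂ n)  = suc n

data BasicN : (X Y : DSet ⊤) → (⟦ X ⟧ → ⟦ Y ⟧) → Set where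
  pᵇ : BasicN N (I ⊕ N) p
  sᵇ : BasicN (I ⊕ N) N s

open Distributive (const ℕ) BasicN public
  using (Derived) renaming (DistributivelyComputable to 𝔇N)

module Sum where

  to : ℕ ⊎ ℕ → ℕ
  to (inj₁ n) = 2 * n + 0
  to (inj₂ n) = 2 * n + 1

  from : ℕ → ℕ ⊎ ℕ
  from 0             = inj₁ 0
  from 1             = inj₂ 0
  from (suc (suc k)) = map⊎ suc suc (from k)

  to-suc : ∀ x → to (map⊎ suc suc x) ≡ suc (suc (to x))
  to-suc (inj₁ n) = lemma n
    where
    lemma : ∀ n → 2 * suc n + 0 ≡ suc (suc (2 * n + 0))
    lemma = solve-∀
  to-suc (inj₂ n) = lemma n
    where
    lemma : ∀ n → 2 * suc n + 1 ≡ suc (suc (2 * n + 1))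
    lemma = solve-∀

  to∘from : ∀ k → to (from k) ≡ k
  to∘from 0             = refl
  to∘from 1             = refl
  to∘from (suc (suc k)) =
    trans (to-suc (from k)) (cong (suc ∘ suc) (to∘from k))

  from∘to : ∀ x → from (to x) ≡ x
  from∘to (inj₁ zero)    = refl
  from∘to (inj₂ zero)    = refl
  from∘to (inj₁ (suc n)) =
    trans (cong from (to-suc (inj₁ n))) (cong (map⊎ suc suc) (from∘to (inj₁ n)))
  from∘to (inj₂ (suc n)) =
    trans (cong from (to-suc (inj₂ n))) (cong (map⊎ suc suc) (from∘to (inj₂ n)))

σ₊ : (ℕ ⊎ ℕ) ↔ ℕ
σ₊ = mk↔ₛ′ Sum.to Sum.from Sum.to∘from Sum.from∘to

module Cantor where

  triangle : ℕ → ℕ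
  triangle n = n * suc n / 2

  to : ℕ × ℕ → ℕ
  to (m , n) = triangle (m + n) + n

  step : ℕ × ℕ → ℕ × ℕ
  step (zero  , n) = suc n , 0
  step (suc m , n) = m , suc n

  from : ℕ → ℕ × ℕ
  from zero    = 0 , 0
  from (suc k) = step (from k)

  triangle-suc : ∀ n → triangle (suc n) ≡ triangle n + suc n
  triangle-suc n = begin
    suc n * suc (suc n) / 2      ≡⟨ cong (_/ 2) (lemma n) ⟩
    (n * suc n + suc n * 2) / 2  ≡⟨ +-distrib-/-∣ʳ (n * suc n) (divides-refl (suc n)) ⟩
    triangle n + suc n * 2 / 2   ≡⟨ cong (triangle n +_) (m*n/n≡m (suc n) 2) ⟩
    triangle n + suc n           ∎
    where
    open ≡-Reasoning
    lemma : ∀ n → suc n * suc (suc n) ≡ n * suc n + suc n * 2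
    lemma = solve-∀

  to-step : ∀ x → to (step x) ≡ suc (to x)
  to-step (zero , n) = begin
    triangle (suc n + 0) + 0  ≡⟨ +-identityʳ _ ⟩
    triangle (suc n + 0)      ≡⟨ cong triangle (+-identityʳ (suc n)) ⟩
    triangle (suc n)          ≡⟨ triangle-suc n ⟩
    triangle n + suc n        ≡⟨ +-suc (triangle n) n ⟩
    suc (triangle n + n)      ∎
    where open ≡-Reasoning
  to-step (suc m , n) =
    trans (cong (λ k → triangle k + suc n) (+-suc m n))
          (+-suc (triangle (suc m + n)) n)

  to∘from : ∀ k → to (from k) ≡ k
  to∘from zero    = refl
  to∘from (suc k) = trans (to-step (from k)) (cong suc (to∘from k))

  from-unique : ∀ k x → to x ≡ k → from k ≡ x
  from-step   : ∀ k x → to (step x) ≡ k → from k ≡ step x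

  from-unique zero    (zero  , zero)  eq = refl
  from-unique (suc k) (zero  , zero)  ()
  from-unique k       (suc m , zero)  eq = from-step k (zero , m) eq
  from-unique k       (m     , suc n) eq = from-step k (suc m , n) eq

  from-step zero    x eq with () ← trans (sym (to-step x)) eq
  from-step (suc k) x eq =
    cong step (from-unique k x (suc-injective (trans (sym (to-step x)) eq)))

  from∘to : ∀ x → from (to x) ≡ x
  from∘to x = from-unique (to x) x refl

σₓ : (ℕ × ℕ) ↔ ℕ
σₓ = mk↔ₛ′ Cantor.to Cantor.from Cantor.to∘from Cantor.from∘to

data ∅-Free : DSet ⊤ → Set where
  base : ∅-Free N
  I    : ∅-Free I
  _⊕_  : ∀ {Y Z} → ∅-Free Y → ∅-Free Z → ∅-Free (Y ⊕ Z)
  _⊗_  : ∀ {Y Z} → ∅-Free Y → ∅-Free Z → ∅-Free (Y ⊗ Z)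

σ : ∀ {X} → ∅-Free X → ⟦ X ⟧ → ℕ
σ base    = id
σ I       = const 0
σ (Y ⊕ Z) = Inverse.to σ₊ ∘ map⊎ (σ Y) (σ Z)
σ (Y ⊗ Z) = Inverse.to σₓ ∘ map× (σ Y) (σ Z)

σ′ : ∀ {X} → ∅-Free X → ℕ → ⟦ X ⟧
σ′ base    = id
σ′ I       = const tt
σ′ (Y ⊕ Z) = map⊎ (σ′ Y) (σ′ Z) ∘ Inverse.from σ₊
σ′ (Y ⊗ Z) = map× (σ′ Y) (σ′ Z) ∘ Inverse.from σₓ

hat : ∀ {X Y} → ∅-Free X → ∅-Free Y → (⟦ X ⟧ → ⟦ Y ⟧) → ℕ → ℕ
hat X Y f = σ Y ∘ f ∘ σ′ X

𝓕 : Pred (ℕ → ℕ) 0ℓ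
𝓕 h = Recursive {1} (h ∘ head)

𝓖 : Pred (ℕ → ℕ) 0ℓ
𝓖 h = ∃₂ λ X Y → ∃₂ λ (x : ∅-Free X) (y : ∅-Free Y) →
      ∃[ f ] 𝔇N X Y f × h ≗ hat x y f

{-# OPTIONS --safe #-}
module Submission where

open import Defs
open import Relation.Unary using (_≐_)

open import Data.Empty using (⊥-elim)
open import Data.Fin using (Fin; zero; suc)
open import Data.Nat using (ℕ; zero; suc; pred; _+_; _*_; _∸_; _<_; z≤n; s≤s; s≤s⁻¹)
open import Data.Nat.Properties
  using (+-suc; +-identityʳ; ≤-reflexive; ≤-trans; <-irrefl; m<m+n;
         m+n∸m≡n; m+n∸n≡m; pred[m∸n]≡m∸[1+n]; ≮⇒≥; m≤n⇒m<n∨m≡n;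
         +-assoc; +-comm; 0∸n≡0; 1+n≢0)
open import Data.Product using (_×_; _,_; proj₁; proj₂; ∃-syntax; <_,_>)
  renaming (map to map×; swap to swap×)
open import Data.Sum using (_⊎_; inj₁; inj₂; [_,_]′; assocˡ) renaming (map to map⊎)
open import Data.Unit using (⊤; tt)
open import Data.Vec using (Vec; []; _∷_; lookup; tabulate; _∷ʳ_)
open import Function using (_∘_; id; const)
open import Relation.Binary.PropositionalEquality
  using (_≡_; refl; sym; trans; cong; cong₂; subst; _≗_; module ≡-Reasoning)

-- 𝓕 ⊆ 𝓖: nested loops can be merged into one, so the distributively computable
-- functions are closed under call, hence under composition (a loop of two rounds)
-- and pairing; primitive recursion and minimization are loops of computable bodies.
--
-- 𝓖 ⊆ 𝓕: on codes every derived function is given by a recursive function.  For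
-- call[f], the codes of the values fⁿ⁺¹(x) are primitive recursive in n and x, and
-- the exit time is the least n for which the code is odd, i.e. lies in Y ⊆ U + Y.
-- To keep that minimization total on numbers that code no element of X, the
-- iteration starts from the code of σ′(m) rather than from m.

-- Loops and their runs

-- `Iterate` adds rounds at the end; a run is peeled from the front and may start in either summand,
-- which suits inductions along a loop.
data Run {X U Y : Set} (f : X ⊎ U → U ⊎ Y) : X ⊎ U → Y → Set where
  done : ∀ {a y} → f a ≡ inj₂ y → Run f a y
  more : ∀ {a u y} → f a ≡ inj₁ u → Run f (inj₂ u) y → Run f a y

-- The `Iterate` argument is an accumulator: it holds the rounds up to the value `f a`, and each
-- round of the run is moved onto its end.
iterate-run : {X U Y : Set} {f : X ⊎ U → U ⊎ Y} {x : X} {a : X ⊎ U} {y : Y} {n : ℕ} →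
  Iterate f x n (f a) → Run f a y → ∃[ k ] Iterate f x k (inj₂ y)
iterate-run {f = f} {x} i (done e)   = _ , subst (Iterate f x _) e i
iterate-run {f = f} {x} i (more e r) =
  iterate-run (again (subst (Iterate f x _) e i)) r

simulate : {X U Y X′ U′ Y′ : Set} {f : X ⊎ U → U ⊎ Y} {f′ : X′ ⊎ U′ → U′ ⊎ Y′}
  (ξ : X → X′) (υ : U → U′) (η : Y → Y′) →
  (∀ a → f′ (map⊎ ξ υ a) ≡ map⊎ υ η (f a)) →
  ∀ {a y} → Run f a y → Run f′ (map⊎ ξ υ a) (η y)
simulate ξ υ η eq {a} (done e)   = done (trans (eq a) (cong (map⊎ υ η) e))
simulate ξ υ η eq {a} (more e r) =
  more (trans (eq a) (cong (map⊎ υ η) e)) (simulate ξ υ η eq r)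

-- Closure properties of functions computed by loops

module Closure {B : Set} (E : B → Set)
  (Basic : (X Y : DSet B) → (El E X → El E Y) → Set) where

  open Distributive E Basic renaming (Derived to Derivable)

  -- The runs serve both as the termination proof and as the proof that the loop computes `g`.
  Computable : (X Y : DSet B) → (El E X → El E Y) → Set
  Computable X Y g =
    ∃[ U ] ∃[ f ] Derivable (X ⊕ U) (U ⊕ Y) f ×
      (∀ x → Run {El E X} {El E U} {El E Y} f (inj₁ x) (g x))

  computable⇒distributive : ∀ {X Y g} → Computable X Y g → DistributivelyComputable X Y g
  computable⇒distributive (U , f , d , r) =
    U , f , d ,
    (λ x → let k , i = iterate-run first (r x) in k , _ , i) ,
    (λ x → refl)

  infixr 9 _∙_

  _∙_ : ∀ {X Y Z f g} → Derivable Y Z g → Derivable X Y f → Derivable X Z (g ∘ f)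
  _∙_ = compose

  sumᵈ : ∀ {X Y X′ Y′ f g} → Derivable X X′ f → Derivable Y Y′ g →
         Derivable (X ⊕ Y) (X′ ⊕ Y′) (map⊎ f g)
  sumᵈ d e = copair (injˡ ∙ d) (injʳ ∙ e)

  timesᵈ : ∀ {X Y X′ Y′ f g} → Derivable X X′ f → Derivable Y Y′ g →
           Derivable (X ⊗ Y) (X′ ⊗ Y′) (map× f g)
  timesᵈ d e = pair (d ∙ projˡ) (e ∙ projʳ)

  swapᵈ : ∀ {X Y} → Derivable (X ⊗ Y) (Y ⊗ X) swap×
  swapᵈ = pair projʳ projˡ

  -- The state `U` of the outer loop is an input of the inner one; only `V` is inner state.
  regroup : {X U V : Set} → X ⊎ (V ⊎ U) → (X ⊎ U) ⊎ V
  regroup = [ inj₁ ∘ inj₁ , [ inj₂ , inj₁ ∘ inj₂ ]′ ]′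

  regroupᵈ : ∀ {X U V} → Derivable (X ⊕ (V ⊕ U)) ((X ⊕ U) ⊕ V) regroup
  regroupᵈ = copair (injˡ ∙ injˡ) (copair injʳ (injˡ ∙ injʳ))

  assocˡᵈ : ∀ {X Y Z} → Derivable (X ⊕ (Y ⊕ Z)) ((X ⊕ Y) ⊕ Z) assocˡ
  assocˡᵈ = copair (injˡ ∙ injˡ) (copair (injˡ ∙ injʳ) injʳ)

  respᶜ : ∀ {X Y f g} → f ≗ g → Computable X Y f → Computable X Y g
  respᶜ eq (U , f , d , r) = U , f , d , λ x → subst (Run f (inj₁ x)) (eq x) (r x)

  derivedᶜ : ∀ {X Y f} → Derivable X Y f → Computable X Y f
  -- With an empty state set the loop exits in its first round.
  derivedᶜ {f = f} d = ∅ , _ , injʳ ∙ copair d initial , λ x → done refl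

  -- An inner loop with state V inside an outer loop with state U is a single
  -- loop with state V ⊕ U.
  callᶜ : ∀ {X U Y g k} → Computable (X ⊕ U) (U ⊕ Y) g →
          (∀ x → Run {El E X} {El E U} {El E Y} g (inj₁ x) (k x)) → Computable X Y k
  callᶜ {X} {U} {Y} {g} (V , f , d , r) t =
    V ⊕ U , F , assocˡᵈ ∙ d ∙ regroupᵈ , λ x → outer (inj₁ x) (t x)
    where
    F : El E (X ⊕ (V ⊕ U)) → El E ((V ⊕ U) ⊕ Y)
    F = assocˡ ∘ f ∘ regroup

    inner-done : ∀ {a b y} → regroup a ≡ b → Run f b (inj₂ y) → Run F a y
    inner-done refl (done e)   = done (cong assocˡ e)
    inner-done refl (more e q) = more (cong assocˡ e) (inner-done refl q)

    inner-more : ∀ {a b u y} → regroup a ≡ b → Run f b (inj₁ u) →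
                 Run F (inj₂ (inj₂ u)) y → Run F a y
    inner-more refl (done e)   q = more (cong assocˡ e) q
    inner-more refl (more e p) q = more (cong assocˡ e) (inner-more refl p q)

    -- A start and an outer state both begin a fresh inner loop, but `regroup` reduces only after a
    -- case split; hence the equations carried by `inner-done` and `inner-more`.
    regroup-inj₂ : ∀ a → regroup (map⊎ id inj₂ a) ≡ inj₁ a
    regroup-inj₂ (inj₁ _) = refl
    regroup-inj₂ (inj₂ _) = refl

    outer : ∀ {y} a → Run g a y → Run F (map⊎ id inj₂ a) y
    outer a (done e)   = inner-done (regroup-inj₂ a) (subst (Run f (inj₁ a)) e (r a))
    outer a (more e q) =
      inner-more (regroup-inj₂ a) (subst (Run f (inj₁ a)) e (r a)) (outer (inj₂ _) q)

  -- A run stays on the side where it starts, so it is the image of a run of `f₁` or of `f₂`.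
  sumᶜ : ∀ {X Y X′ Y′ f g} → Computable X X′ f → Computable Y Y′ g →
         Computable (X ⊕ Y) (X′ ⊕ Y′) (map⊎ f g)
  sumᶜ {X} {Y} {X′} {Y′} {f} {g} (U , f₁ , d₁ , r₁) (V , f₂ , d₂ , r₂) =
    U ⊕ V , F ,
    copair (copair (sumᵈ injˡ injˡ ∙ d₁ ∙ injˡ) (sumᵈ injʳ injʳ ∙ d₂ ∙ injˡ))
           (copair (sumᵈ injˡ injˡ ∙ d₁ ∙ injʳ) (sumᵈ injʳ injʳ ∙ d₂ ∙ injʳ)) ,
    λ { (inj₁ x) → simulate {f = f₁} {F} inj₁ inj₁ inj₁
                     (λ { (inj₁ _) → refl ; (inj₂ _) → refl }) (r₁ x)
      ; (inj₂ y) → simulate {f = f₂} {F} inj₂ inj₂ inj₂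
                     (λ { (inj₁ _) → refl ; (inj₂ _) → refl }) (r₂ y) }
    where
    F : El E ((X ⊕ Y) ⊕ (U ⊕ V)) → El E ((U ⊕ V) ⊕ (X′ ⊕ Y′))
    F = [ [ map⊎ inj₁ inj₁ ∘ f₁ ∘ inj₁ , map⊎ inj₂ inj₂ ∘ f₂ ∘ inj₁ ]′
        , [ map⊎ inj₁ inj₁ ∘ f₁ ∘ inj₂ , map⊎ inj₂ inj₂ ∘ f₂ ∘ inj₂ ]′ ]′

  infixr 9 _∙ᶜ_

  -- A composite is the loop that applies f in its first round and g in its second.
  _∙ᶜ_ : ∀ {X Y Z f g} → Computable Y Z g → Computable X Y f → Computable X Z (g ∘ f)
  c ∙ᶜ b = callᶜ (sumᶜ b c) (λ x → more refl (done refl))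

  copairᶜ : ∀ {X Y Z f g} → Computable X Z f → Computable Y Z g →
            Computable (X ⊕ Y) Z [ f , g ]′
  copairᶜ b c = respᶜ (λ { (inj₁ _) → refl ; (inj₂ _) → refl })
                      (derivedᶜ (copair identity identity) ∙ᶜ sumᶜ b c)

  -- The parameter rides along in every state; distributivity sorts it into the summand that the
  -- loop body returns.
  strengthᶜ : ∀ {P X Y f} → Computable X Y f → Computable (P ⊗ X) (P ⊗ Y) (map× id f)
  strengthᶜ {P} {X} {Y} (U , f , d , r) =
    P ⊗ U , F ,
    distrib ∙ timesᵈ identity d ∙ copair (timesᵈ identity injˡ) (timesᵈ identity injʳ) ,
    λ { (z , x) → simulate {f = f} {F} (z ,_) (z ,_) (z ,_) (commutes z) (r x) }
    where
    F : El E (P ⊗ X ⊕ P ⊗ U) → El E (P ⊗ U ⊕ P ⊗ Y)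
    F = δ⁻¹ ∘ map× id f ∘ [ map× id inj₁ , map× id inj₂ ]′

    δ⁻¹-map : ∀ z b → δ⁻¹ (z , b) ≡ map⊎ (z ,_) (z ,_) b
    δ⁻¹-map z (inj₁ _) = refl
    δ⁻¹-map z (inj₂ _) = refl

    commutes : ∀ z a → F (map⊎ (z ,_) (z ,_) a) ≡ map⊎ (z ,_) (z ,_) (f a)
    commutes z (inj₁ x) = δ⁻¹-map z (f (inj₁ x))
    commutes z (inj₂ u) = δ⁻¹-map z (f (inj₂ u))

  -- The input is duplicated; first `g` runs beside a spare copy, then, after a swap, `f` runs on
  -- that copy beside the result.
  pairᶜ : ∀ {X Y Z f g} → Computable Z X f → Computable Z Y g →
          Computable Z (X ⊗ Y) < f , g >
  pairᶜ b c =
    derivedᶜ swapᵈ ∙ᶜ strengthᶜ b ∙ᶜ derivedᶜ swapᵈ ∙ᶜ strengthᶜ c ∙ᶜ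
    derivedᶜ (pair identity identity)

  distribᶜ : ∀ {X Y Z W f g} → Computable (X ⊗ Y) W f → Computable (X ⊗ Z) W g →
             Computable (X ⊗ (Y ⊕ Z)) W ([ f , g ]′ ∘ δ⁻¹)
  distribᶜ b c = copairᶜ b c ∙ᶜ derivedᶜ distrib

-- Primitive recursion and minimization as loops

open Distributive (const ℕ) BasicN using () renaming (module Derived to Derivable)
open Derivable using (basic; injˡ; injʳ; projˡ; projʳ; identity; terminal; distrib;
                    compose; copair; pair; initial)
open Closure (const ℕ) BasicN

zeroᵈ : ∀ {X} → Derived X N (const 0)
zeroᵈ = basic sᵇ ∙ injˡ ∙ terminal

sucᵈ : Derived N N suc
sucᵈ = basic sᵇ ∙ injʳ

-- The state `(((m , i) , a) , n)` keeps `a` equal to `f (m , i)` and counts in `n` the rounds left;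
-- `p` applied to `n` decides between `stop` and `next`.
primRecᶜ : ∀ {M} {g : ⟦ M ⟧ → ℕ} {h : ⟦ (M ⊗ N) ⊗ N ⟧ → ℕ} {f : ⟦ M ⊗ N ⟧ → ℕ} →
  Computable M N g → Computable ((M ⊗ N) ⊗ N) N h →
  (∀ m → f (m , 0) ≡ g m) → (∀ m n → f (m , suc n) ≡ h ((m , n) , f (m , n))) →
  Computable (M ⊗ N) N f
primRecᶜ {M} {g} {h} {f} c d f-zero f-suc =
  callᶜ bodyᶜ λ { (m , n) → more refl
    -- `init` stores `g m`, whereas `run` expects `f (m , 0)`.
    (subst (λ a → Run body (inj₂ (((m , 0) , a) , n)) (f (m , n))) (f-zero m) (run m n 0)) }
  where
  State : DSet ⊤
  State = ((M ⊗ N) ⊗ N) ⊗ N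

  init : ⟦ M ⊗ N ⟧ → ⟦ State ⊕ N ⟧
  init (m , n) = inj₁ (((m , 0) , g m) , n)

  stop : ⟦ ((M ⊗ N) ⊗ N) ⊗ I ⟧ → ⟦ State ⊕ N ⟧
  stop ((_ , a) , _) = inj₂ a

  next : ⟦ ((M ⊗ N) ⊗ N) ⊗ N ⟧ → ⟦ State ⊕ N ⟧
  next (((m , i) , a) , n) = inj₁ (((m , suc i) , h ((m , i) , a)) , n)

  body : ⟦ (M ⊗ N) ⊕ State ⟧ → ⟦ State ⊕ N ⟧
  body = [ init , [ stop , next ]′ ∘ δ⁻¹ ∘ map× id p ]′

  initᶜ : Computable (M ⊗ N) (State ⊕ N) init
  initᶜ = derivedᶜ injˡ ∙ᶜ pairᶜ (pairᶜ (derivedᶜ (pair projˡ zeroᵈ)) (c ∙ᶜ derivedᶜ projˡ))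
                                 (derivedᶜ projʳ)

  nextᶜ : Computable State (State ⊕ N) next
  nextᶜ = derivedᶜ injˡ ∙ᶜ
    pairᶜ (pairᶜ (derivedᶜ (timesᵈ identity sucᵈ ∙ projˡ ∙ projˡ)) (d ∙ᶜ derivedᶜ projˡ))
          (derivedᶜ projʳ)

  bodyᶜ : Computable ((M ⊗ N) ⊕ State) (State ⊕ N) body
  bodyᶜ = copairᶜ initᶜ
    (distribᶜ (derivedᶜ (injʳ ∙ projʳ ∙ projˡ)) nextᶜ ∙ᶜ
     derivedᶜ (timesᵈ identity (basic pᵇ)))

  run : ∀ m n i → Run body (inj₂ (((m , i) , f (m , i)) , n)) (f (m , i + n))
  run m zero    i = done (cong (λ j → inj₂ (f (m , j))) (sym (+-identityʳ i)))
  run m (suc n) i rewrite +-suc i n =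
    more (cong (λ a → inj₁ (((m , suc i) , a) , n)) (sym (f-suc m i))) (run m n (suc i))

-- Linear search upwards from 0; the induction is on the distance `d` that remains to the least
-- zero.
minimizeᶜ : ∀ {M} {f : ⟦ M ⊗ N ⟧ → ℕ} {g : ⟦ M ⟧ → ℕ} → Computable (M ⊗ N) N f →
  (∀ m → IsLeast (λ n → f (m , n) ≡ 0) (g m)) → Computable M N g
minimizeᶜ {M} {f} {g} c least = callᶜ bodyᶜ λ m → more refl (run m (g m) 0 refl)
  where
  stop : ⟦ (M ⊗ N) ⊗ I ⟧ → ⟦ (M ⊗ N) ⊕ N ⟧
  stop ((_ , i) , _) = inj₂ i

  next : ⟦ (M ⊗ N) ⊗ N ⟧ → ⟦ (M ⊗ N) ⊕ N ⟧
  next ((m , i) , _) = inj₁ (m , suc i)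

  body : ⟦ M ⊕ (M ⊗ N) ⟧ → ⟦ (M ⊗ N) ⊕ N ⟧
  body = [ inj₁ ∘ (_, 0) , [ stop , next ]′ ∘ δ⁻¹ ∘ < id , p ∘ f > ]′

  bodyᶜ : Computable (M ⊕ (M ⊗ N)) ((M ⊗ N) ⊕ N) body
  bodyᶜ = copairᶜ (derivedᶜ (injˡ ∙ pair identity zeroᵈ))
    (distribᶜ (derivedᶜ (injʳ ∙ projʳ ∙ projˡ))
              (derivedᶜ (injˡ ∙ timesᵈ identity sucᵈ ∙ projˡ)) ∙ᶜ
     pairᶜ (derivedᶜ identity) (derivedᶜ (basic pᵇ) ∙ᶜ c))

  step-zero : ∀ m i → f (m , i) ≡ 0 → body (inj₂ (m , i)) ≡ inj₂ i
  step-zero m i eq rewrite eq = refl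

  step-suc : ∀ m i {n} → f (m , i) ≡ suc n → body (inj₂ (m , i)) ≡ inj₁ (m , suc i)
  step-suc m i eq rewrite eq = refl

  run : ∀ m d i → i + d ≡ g m → Run body (inj₂ (m , i)) (g m)
  run m zero    i eq with refl ← trans (sym (+-identityʳ i)) eq =
    done (step-zero m (g m) (proj₁ (least m)))
  run m (suc d) i eq with f (m , i) in fmi
  -- A zero at `i` would lie below the least one, since `i + suc d` is `g m`.
  ... | zero  = ⊥-elim (<-irrefl refl (≤-trans (m<m+n i {suc d} (s≤s z≤n))
                  (≤-trans (≤-reflexive eq) (proj₂ (least m) i fmi))))
  ... | suc _ = more (step-suc m i fmi) (run m d (suc i) (trans (sym (+-suc i d)) eq))

-- Vectors as derived sets; recursive functions as loops

N^ : ℕ → DSet ⊤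
N^ zero    = I
N^ (suc k) = N ⊗ N^ k

vec : ∀ k → ⟦ N^ k ⟧ → Vec ℕ k
vec zero    _       = []
vec (suc k) (n , m) = n ∷ vec k m

lookupᵈ : ∀ {k} (i : Fin k) → Derived (N^ k) N (λ m → lookup (vec k m) i)
lookupᵈ zero    = projˡ
lookupᵈ (suc i) = lookupᵈ i ∙ projʳ

tabulateᶜ : ∀ {X} k (g : Fin k → ⟦ X ⟧ → ℕ) → (∀ i → Computable X N (g i)) →
  ∃[ t ] Computable X (N^ k) t × (∀ x → vec k (t x) ≡ tabulate (λ i → g i x))
tabulateᶜ zero    g c = _ , derivedᶜ terminal , λ _ → refl
tabulateᶜ (suc k) g c with t , d , eq ← tabulateᶜ k (g ∘ suc) (c ∘ suc) =
  _ , pairᶜ (c zero) d , λ x → cong (g zero x ∷_) (eq x)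

-- Recursion and minimization act on the last entry of a vector, while the loops above have it as
-- the right factor of `M ⊗ N`; `snoc` and `unsnoc` pass between the two forms.
snoc : ∀ k → ⟦ N^ k ⊗ N ⟧ → ⟦ N^ (suc k) ⟧
snoc zero    (_ , n)       = n , tt
snoc (suc k) ((a , m) , n) = a , snoc k (m , n)

snocᵈ : ∀ k → Derived (N^ k ⊗ N) (N^ (suc k)) (snoc k)
snocᵈ zero    = pair projʳ terminal
snocᵈ (suc k) = pair (projˡ ∙ projˡ) (snocᵈ k ∙ timesᵈ projʳ identity)

vec-snoc : ∀ k m n → vec (suc k) (snoc k (m , n)) ≡ vec k m ∷ʳ n
vec-snoc zero    _       n = refl
vec-snoc (suc k) (a , m) n = cong (a ∷_) (vec-snoc k m n)

unsnoc : ∀ k → ⟦ N^ (suc k) ⟧ → ⟦ N^ k ⊗ N ⟧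
unsnoc zero    (n , _) = tt , n
unsnoc (suc k) (a , m) = (a , proj₁ (unsnoc k m)) , proj₂ (unsnoc k m)

unsnocᵈ : ∀ k → Derived (N^ (suc k)) (N^ k ⊗ N) (unsnoc k)
unsnocᵈ zero    = pair terminal projˡ
unsnocᵈ (suc k) =
  pair (timesᵈ identity (projˡ ∙ unsnocᵈ k)) (projʳ ∙ unsnocᵈ k ∙ projʳ)

vec-unsnoc : ∀ k v → vec k (proj₁ (unsnoc k v)) ∷ʳ proj₂ (unsnoc k v) ≡ vec (suc k) v
vec-unsnoc zero    (n , _) = refl
vec-unsnoc (suc k) (a , m) = cong (a ∷_) (vec-unsnoc k m)

recursive⇒computable : ∀ {k} {f : Vec ℕ k → ℕ} → Recursive f → Computable (N^ k) N (f ∘ vec k)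
recursive⇒computable zeroᶠ     = derivedᶜ zeroᵈ
recursive⇒computable sucᶠ      = derivedᶜ (sucᵈ ∙ projˡ)
recursive⇒computable (projᶠ i) = derivedᶜ (lookupᵈ i)
recursive⇒computable (substᶠ {k} {j} {f} {g} c d)
  with t , e , eq ← tabulateᶜ k (λ i → g i ∘ vec j) (λ i → recursive⇒computable (d i)) =
  respᶜ (λ m → cong f (eq m)) (recursive⇒computable c ∙ᶜ e)
recursive⇒computable (primRec {k} {g} {h} {f} c d f-zero f-suc) =
  respᶜ (λ v → cong f (vec-unsnoc k v))
    (primRecᶜ {f = λ (m , n) → f (vec k m ∷ʳ n)}
       (recursive⇒computable c)
       -- Appending `n` and then the previous value `a` gives the argument order of `h`.
       (respᶜ (λ { ((m , n) , a) → cong h (trans (vec-snoc (suc k) (snoc k (m , n)) a)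
                                                 (cong (_∷ʳ a) (vec-snoc k m n))) })
         (recursive⇒computable d ∙ᶜ derivedᶜ (snocᵈ (suc k) ∙ timesᵈ (snocᵈ k) identity)))
       (λ m → f-zero (vec k m))
       (λ m n → f-suc (vec k m) n) ∙ᶜ
     derivedᶜ (unsnocᵈ k))
recursive⇒computable (minimize {k} {f} {g} c _ least) =
  minimizeᶜ {f = λ (m , n) → f (vec k m ∷ʳ n)}
    (respᶜ (λ (m , n) → cong f (vec-snoc k m n)) (recursive⇒computable c ∙ᶜ derivedᶜ (snocᵈ k)))
    (λ m → least (vec k m))
recursive⇒computable (resp eq c) = respᶜ (λ m → eq _) (recursive⇒computable c)

𝓕⊆𝓖 : ∀ {h} → 𝓕 h → 𝓖 h
𝓕⊆𝓖 {h} c = N , N , base , base , h ,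
  computable⇒distributive (recursive⇒computable c ∙ᶜ derivedᶜ (pair identity terminal)) ,
  λ _ → refl

-- Elementary recursive functions

-- Records, so that the function can be inferred from a proof that it is recursive.
record Recursive₁ (f : ℕ → ℕ) : Set where
  constructor unary
  field recursive₁ : Recursive {1} (λ v → f (lookup v zero))

record Recursive₂ (f : ℕ → ℕ → ℕ) : Set where
  constructor binary
  field recursive₂ : Recursive {2} (λ v → f (lookup v zero) (lookup v (suc zero)))

record Recursive₃ (f : ℕ → ℕ → ℕ → ℕ) : Set where
  constructor ternary
  field
    recursive₃ : Recursive {3}
      (λ v → f (lookup v zero) (lookup v (suc zero)) (lookup v (suc (suc zero))))

open Recursive₁
open Recursive₂
open Recursive₃

subst₁ : ∀ {k f} {g : Vec ℕ k → ℕ} → Recursive₁ f → Recursive g → Recursive (λ v → f (g v))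
subst₁ {g = g} c d = substᶠ {g = λ _ → g} (recursive₁ c) (λ { zero → d })

subst₂ : ∀ {k f} {g h : Vec ℕ k → ℕ} → Recursive₂ f → Recursive g → Recursive h →
         Recursive (λ v → f (g v) (h v))
subst₂ {g = g} {h} c d e =
  substᶠ {g = lookup (g ∷ h ∷ [])} (recursive₂ c) (λ { zero → d ; (suc zero) → e })

subst₃ : ∀ {k f} {g h i : Vec ℕ k → ℕ} → Recursive₃ f → Recursive g → Recursive h →
         Recursive i → Recursive (λ v → f (g v) (h v) (i v))
subst₃ {g = g} {h} {i} c d e b =
  substᶠ {g = lookup (g ∷ h ∷ i ∷ [])} (recursive₃ c)
    (λ { zero → d ; (suc zero) → e ; (suc (suc zero)) → b })

arg₀ : ∀ {k} → Recursive {suc k} (λ v → lookup v zero)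
arg₀ = projᶠ zero

arg₁ : ∀ {k} → Recursive {suc (suc k)} (λ v → lookup v (suc zero))
arg₁ = projᶠ (suc zero)

arg₂ : ∀ {k} → Recursive {suc (suc (suc k))} (λ v → lookup v (suc (suc zero)))
arg₂ = projᶠ (suc (suc zero))

resp₁ : ∀ {f g} → f ≗ g → Recursive₁ f → Recursive₁ g
resp₁ eq (unary c) = unary (resp (λ v → eq (lookup v zero)) c)

id-recursive : Recursive₁ id
id-recursive = unary arg₀

zero-recursive : Recursive₁ (const 0)
zero-recursive = unary zeroᶠ

suc-recursive : Recursive₁ suc
suc-recursive = unary (resp (λ { (_ ∷ []) → refl }) sucᶠ)

infixr 9 _∙ᶠ_

_∙ᶠ_ : ∀ {f g} → Recursive₁ f → Recursive₁ g → Recursive₁ (f ∘ g)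
c ∙ᶠ unary d = unary (subst₁ c d)

lift₂ : ∀ {f g h} → Recursive₂ f → Recursive₁ g → Recursive₁ h →
        Recursive₁ (λ n → f (g n) (h n))
lift₂ c (unary d) (unary e) = unary (subst₂ c d e)

lift₃ : ∀ {f g h i} → Recursive₃ f → Recursive₁ g → Recursive₁ h → Recursive₁ i →
        Recursive₁ (λ n → f (g n) (h n) (i n))
lift₃ c (unary d) (unary e) (unary b) = unary (subst₃ c d e b)

primRec₁ : ∀ {f} h → Recursive₂ h → f 0 ≡ 0 → (∀ n → f (suc n) ≡ h n (f n)) → Recursive₁ f
primRec₁ h (binary c) f-zero f-suc =
  unary (primRec zeroᶠ c (λ { [] → f-zero }) (λ { [] → f-suc }))

primRec₂ : ∀ {f g} h → Recursive₁ g → Recursive₃ h → (∀ m → f m 0 ≡ g m) →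
           (∀ m n → f m (suc n) ≡ h m n (f m n)) → Recursive₂ f
primRec₂ h (unary c) (ternary d) f-zero f-suc =
  binary (primRec c d (λ { (m ∷ []) → f-zero m }) (λ { (m ∷ []) → f-suc m }))

+-recursive : Recursive₂ _+_
+-recursive = primRec₂ (λ _ _ k → suc k) id-recursive (ternary (subst₁ suc-recursive arg₂))
  +-identityʳ +-suc

pred-recursive : Recursive₁ pred
pred-recursive = primRec₁ (λ n _ → n) (binary arg₀) refl (λ _ → refl)

∸-recursive : Recursive₂ _∸_
∸-recursive = primRec₂ (λ _ _ k → pred k) id-recursive (ternary (subst₁ pred-recursive arg₂))
  (λ _ → refl) (λ m n → sym (pred[m∸n]≡m∸[1+n] m n))

if-zero : ℕ → ℕ → ℕ → ℕ
if-zero x y zero    = x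
if-zero x y (suc _) = y

if-zero-recursive : Recursive₃ if-zero
if-zero-recursive = ternary (primRec arg₀ arg₁
  (λ { (_ ∷ _ ∷ []) → refl }) (λ { (_ ∷ _ ∷ []) _ → refl }))

parity : ℕ → ℕ
parity zero    = 0
parity (suc n) = 1 ∸ parity n

parity-recursive : Recursive₁ parity
parity-recursive = primRec₁ (λ _ k → 1 ∸ k)
  (binary (subst₂ ∸-recursive (subst₁ suc-recursive zeroᶠ) arg₁)) refl (λ _ → refl)

-- Halving rounds down, so it grows exactly on leaving an odd number.
half : ℕ → ℕ
half zero    = 0
half (suc n) = half n + parity n

half-recursive : Recursive₁ half
half-recursive = primRec₁ (λ n k → k + parity n)
  (binary (subst₂ +-recursive arg₁ (subst₁ parity-recursive arg₀)))
  refl (λ _ → refl)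

parity-suc-suc : ∀ n → parity (suc (suc n)) ≡ parity n
parity-suc-suc zero          = refl
parity-suc-suc (suc zero)    = refl
parity-suc-suc (suc (suc n)) = cong (λ k → 1 ∸ (1 ∸ k)) (parity-suc-suc n)

parity+parity-suc : ∀ n → parity n + parity (suc n) ≡ 1
parity+parity-suc zero          = refl
parity+parity-suc (suc zero)    = refl
parity+parity-suc (suc (suc n)) =
  trans (cong (λ k → k + (1 ∸ k)) (parity-suc-suc n)) (parity+parity-suc n)

half-suc-suc : ∀ n → half (suc (suc n)) ≡ suc (half n)
half-suc-suc n = begin
  half n + parity n + parity (suc n)   ≡⟨ +-assoc (half n) _ _ ⟩
  half n + (parity n + parity (suc n)) ≡⟨ cong (half n +_) (parity+parity-suc n) ⟩
  half n + 1                           ≡⟨ +-comm (half n) 1 ⟩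
  suc (half n)                         ∎
  where open ≡-Reasoning

even odd : ℕ → ℕ
even n = Sum.to (inj₁ n)
odd  n = Sum.to (inj₂ n)

parity-even : ∀ n → parity (even n) ≡ 0
parity-even zero    = refl
parity-even (suc n) = trans (cong parity (Sum.to-suc (inj₁ n)))
  (trans (parity-suc-suc (even n)) (parity-even n))

parity-odd : ∀ n → parity (odd n) ≡ 1
parity-odd zero    = refl
parity-odd (suc n) = trans (cong parity (Sum.to-suc (inj₂ n)))
  (trans (parity-suc-suc (odd n)) (parity-odd n))

half-even : ∀ n → half (even n) ≡ n
half-even zero    = refl
half-even (suc n) = trans (cong half (Sum.to-suc (inj₁ n)))
  (trans (half-suc-suc (even n)) (cong suc (half-even n)))

half-odd : ∀ n → half (odd n) ≡ n
half-odd zero    = refl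
half-odd (suc n) = trans (cong half (Sum.to-suc (inj₂ n)))
  (trans (half-suc-suc (odd n)) (cong suc (half-odd n)))

double-recursive : Recursive₁ (2 *_)
double-recursive = lift₂ +-recursive id-recursive (lift₂ +-recursive id-recursive zero-recursive)

even-recursive : Recursive₁ even
even-recursive = lift₂ +-recursive double-recursive zero-recursive

odd-recursive : Recursive₁ odd
odd-recursive = lift₂ +-recursive double-recursive (suc-recursive ∙ᶠ zero-recursive)

-- On codes of a sum this is the copairing: the parity is the tag and the half is the code of the
-- element.
by-parity : (ℕ → ℕ) → (ℕ → ℕ) → ℕ → ℕ
by-parity f g n = if-zero (f (half n)) (g (half n)) (parity n)

by-parity-recursive : ∀ {f g} → Recursive₁ f → Recursive₁ g → Recursive₁ (by-parity f g)
by-parity-recursive c d = lift₃ if-zero-recursive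
  (c ∙ᶠ half-recursive) (d ∙ᶠ half-recursive) parity-recursive

by-parity-even : ∀ f g n → by-parity f g (even n) ≡ f n
by-parity-even f g n rewrite parity-even n = cong f (half-even n)

by-parity-odd : ∀ f g n → by-parity f g (odd n) ≡ g n
by-parity-odd f g n rewrite parity-odd n = cong g (half-odd n)

-- Cantor pairing and unpairing

open Cantor using (triangle)

triangle-recursive : Recursive₁ triangle
triangle-recursive = primRec₁ (λ n k → k + suc n)
  (binary (subst₂ +-recursive arg₁ (subst₁ suc-recursive arg₀))) refl Cantor.triangle-suc

⟨_,_⟩ : ℕ → ℕ → ℕ
⟨ m , n ⟩ = Cantor.to (m , n)

cantor-recursive : Recursive₂ ⟨_,_⟩
cantor-recursive = binary
  (subst₂ +-recursive (subst₁ triangle-recursive (subst₂ +-recursive arg₀ arg₁)) arg₁)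

-- `diagonal k` numbers the antidiagonal of the pair coded by `k`; both projections are recovered
-- from it.
π₁ π₂ diagonal : ℕ → ℕ
π₁ = proj₁ ∘ Cantor.from
π₂ = proj₂ ∘ Cantor.from
diagonal k = π₁ k + π₂ k

π₂-diagonal : ∀ k → π₂ k ≡ k ∸ triangle (diagonal k)
π₂-diagonal k = begin
  π₂ k            ≡⟨ m+n∸m≡n t (π₂ k) ⟨
  (t + π₂ k) ∸ t  ≡⟨ cong (_∸ t) (Cantor.to∘from k) ⟩
  k ∸ t           ∎
  where
  open ≡-Reasoning
  t : ℕ
  t = triangle (diagonal k)

π₁-diagonal : ∀ k → π₁ k ≡ diagonal k ∸ (k ∸ triangle (diagonal k))
π₁-diagonal k =
  trans (sym (m+n∸n≡m (π₁ k) (π₂ k))) (cong (diagonal k ∸_) (π₂-diagonal k))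

-- The enumeration leaves an antidiagonal only at `m = 0`, which is exactly when `1 ∸ m` is 1.
diagonal-step : ∀ ((m , n) : ℕ × ℕ) →
  proj₁ (Cantor.step (m , n)) + proj₂ (Cantor.step (m , n)) ≡ (m + n) + (1 ∸ m)
diagonal-step (zero  , n) = trans (+-identityʳ (suc n)) (+-comm 1 n)
diagonal-step (suc m , n) =
  trans (+-suc m n) (sym (trans (cong (suc (m + n) +_) (0∸n≡0 m)) (+-identityʳ _)))

-- By `π₁-diagonal` the increment `1 ∸ π₁ k` is a function of `k` and the current diagonal alone, so
-- a recursion on single numbers replaces one on pairs.
diagonal-recursive : Recursive₁ diagonal
diagonal-recursive = primRec₁ (λ k d → d + (1 ∸ (d ∸ (k ∸ triangle d))))
  (binary
    (subst₂ +-recursive arg₁ (subst₂ ∸-recursive (subst₁ suc-recursive zeroᶠ)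
      (subst₂ ∸-recursive arg₁ (subst₂ ∸-recursive arg₀ (subst₁ triangle-recursive arg₁))))))
  refl
  (λ k → trans (diagonal-step (Cantor.from k))
               (cong (λ m → diagonal k + (1 ∸ m)) (π₁-diagonal k)))

π₂-recursive : Recursive₁ π₂
π₂-recursive = resp₁ (sym ∘ π₂-diagonal)
  (lift₂ ∸-recursive id-recursive (triangle-recursive ∙ᶠ diagonal-recursive))

π₁-recursive : Recursive₁ π₁
π₁-recursive = resp₁ (sym ∘ π₁-diagonal)
  (lift₂ ∸-recursive diagonal-recursive
    (lift₂ ∸-recursive id-recursive (triangle-recursive ∙ᶠ diagonal-recursive)))

-- Derived functions on codes

-- σ extended to the derived sets in which ∅ occurs, since ∅ may occur in the
-- state set of a loop and in the intermediate sets of a derivation.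
code : ∀ X → ⟦ X ⟧ → ℕ
code N       n        = n
code I       _        = 0
code (X ⊕ Y) (inj₁ x) = even (code X x)
code (X ⊕ Y) (inj₂ y) = odd (code Y y)
code (X ⊗ Y) (x , y)  = ⟨ code X x , code Y y ⟩

code-σ : ∀ {X} (F : ∅-Free X) x → code X x ≡ σ F x
code-σ base    x        = refl
code-σ I       x        = refl
code-σ (F ⊕ G) (inj₁ x) = cong even (code-σ F x)
code-σ (F ⊕ G) (inj₂ y) = cong odd (code-σ G y)
code-σ (F ⊗ G) (x , y)  = cong₂ ⟨_,_⟩ (code-σ F x) (code-σ G y)

π₁-code : ∀ X Y (z : ⟦ X ⊗ Y ⟧) → π₁ (code (X ⊗ Y) z) ≡ code X (proj₁ z)
π₁-code X Y (x , y) = cong proj₁ (Cantor.from∘to (code X x , code Y y))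

π₂-code : ∀ X Y (z : ⟦ X ⊗ Y ⟧) → π₂ (code (X ⊗ Y) z) ≡ code Y (proj₂ z)
π₂-code X Y (x , y) = cong proj₂ (Cantor.from∘to (code X x , code Y y))

-- Only codes of elements of `X` are constrained, so any `h` tracks a map out of `∅`.
Tracked : ∀ X Y → (⟦ X ⟧ → ⟦ Y ⟧) → Set
Tracked X Y f = ∃[ h ] Recursive₁ h × (∀ x → h (code X x) ≡ code Y (f x))

-- Induction on the derivation: sums are analysed by parity and halving, products by `π₁` and `π₂`.
derived⇒tracked : ∀ {X Y f} → Derived X Y f → Tracked X Y f
derived⇒tracked (basic pᵇ) =
  code (I ⊕ N) ∘ p ,
  -- The value at 0 is the code of `inj₁ tt`, which is `even 0`, hence 0.
  primRec₁ (λ n _ → odd n) (binary (subst₁ odd-recursive arg₀)) refl (λ _ → refl) ,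
  λ _ → refl
derived⇒tracked (basic sᵇ) =
  by-parity (const 0) suc , by-parity-recursive zero-recursive suc-recursive ,
  λ { (inj₁ _) → refl ; (inj₂ n) → by-parity-odd (const 0) suc n }
derived⇒tracked injˡ = even , even-recursive , λ _ → refl
derived⇒tracked injʳ = odd , odd-recursive , λ _ → refl
derived⇒tracked (projˡ {X} {Y}) = π₁ , π₁-recursive , π₁-code X Y
derived⇒tracked (projʳ {X} {Y}) = π₂ , π₂-recursive , π₂-code X Y
derived⇒tracked identity = id , id-recursive , λ _ → refl
derived⇒tracked initial  = const 0 , zero-recursive , λ ()
derived⇒tracked terminal = const 0 , zero-recursive , λ _ → refl
derived⇒tracked (distrib {X} {Y} {Z}) =
  f ,
  lift₃ if-zero-recursive
    (even-recursive ∙ᶠ pairing) (odd-recursive ∙ᶠ pairing) (parity-recursive ∙ᶠ π₂-recursive) ,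
  tracks
  where
  f : ℕ → ℕ
  -- The tag sits in the second component: its parity moves to the outside and its half stays in the
  -- pair.
  f c = if-zero (even ⟨ π₁ c , half (π₂ c) ⟩) (odd ⟨ π₁ c , half (π₂ c) ⟩) (parity (π₂ c))

  pairing : Recursive₁ (λ c → ⟨ π₁ c , half (π₂ c) ⟩)
  pairing = lift₂ cantor-recursive π₁-recursive (half-recursive ∙ᶠ π₂-recursive)

  tracks : ∀ z → f (code (X ⊗ (Y ⊕ Z)) z) ≡ code (X ⊗ Y ⊕ X ⊗ Z) (δ⁻¹ z)
  tracks (x , inj₁ y)
    rewrite π₁-code X (Y ⊕ Z) (x , inj₁ y) | π₂-code X (Y ⊕ Z) (x , inj₁ y)
          | parity-even (code Y y) | half-even (code Y y) = refl
  tracks (x , inj₂ z)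
    rewrite π₁-code X (Y ⊕ Z) (x , inj₂ z) | π₂-code X (Y ⊕ Z) (x , inj₂ z)
          | parity-odd (code Z z) | half-odd (code Z z) = refl
derived⇒tracked (compose {f = f} d e)
  with h , c , t ← derived⇒tracked d | k , b , u ← derived⇒tracked e =
  h ∘ k , c ∙ᶠ b , λ x → trans (cong h (u x)) (t (f x))
derived⇒tracked (copair {X} {Y} d e)
  with h , c , t ← derived⇒tracked d | k , b , u ← derived⇒tracked e =
  by-parity h k , by-parity-recursive c b ,
  λ { (inj₁ x) → trans (by-parity-even h k (code X x)) (t x)
    ; (inj₂ y) → trans (by-parity-odd h k (code Y y)) (u y) }
derived⇒tracked (pair d e)
  with h , c , t ← derived⇒tracked d | k , b , u ← derived⇒tracked e =
  (λ n → ⟨ h n , k n ⟩) , lift₂ cantor-recursive c b , λ x → cong₂ ⟨_,_⟩ (t x) (u x)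
derived⇒tracked (Derivable.resp {Y = Y} eq d) with h , c , t ← derived⇒tracked d =
  h , c , λ x → trans (t x) (cong (code Y) (eq x))

-- `σ′ F` decodes every number, but not every number is a code, as `I` shows; this recoding makes
-- tracking applicable to arbitrary inputs.
normalize-recursive : ∀ {X} (F : ∅-Free X) → Recursive₁ (code X ∘ σ′ F)
normalize-recursive base = id-recursive
normalize-recursive I    = zero-recursive
normalize-recursive {X ⊕ Y} (F ⊕ G) =
  resp₁ (λ n → trans (cong (by-parity f g) (sym (Sum.to∘from n))) (eq (Sum.from n)))
    (by-parity-recursive (even-recursive ∙ᶠ normalize-recursive F)
                         (odd-recursive ∙ᶠ normalize-recursive G))
  where
  f g : ℕ → ℕ
  f = even ∘ code X ∘ σ′ F
  g = odd ∘ code Y ∘ σ′ G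

  eq : ∀ a → by-parity f g (Sum.to a) ≡ code (X ⊕ Y) (map⊎ (σ′ F) (σ′ G) a)
  eq (inj₁ m) = by-parity-even f g m
  eq (inj₂ n) = by-parity-odd f g n
normalize-recursive (F ⊗ G) =
  lift₂ cantor-recursive (normalize-recursive F ∙ᶠ π₁-recursive)
                         (normalize-recursive G ∙ᶠ π₂-recursive)

-- Orbits and exit times of a loop

module Orbit (X U Y : DSet ⊤) (f : ⟦ X ⊕ U ⟧ → ⟦ U ⊕ Y ⟧) (h : ℕ → ℕ)
  (tracks : ∀ a → h (code (X ⊕ U) a) ≡ code (U ⊕ Y) (f a)) where

  -- The even code 2u of ⟨u,0⟩ ∈ U + Y becomes the code 2u + 1 of ⟨u,1⟩ ∈ X + U.
  orbit : ℕ → ℕ → ℕ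
  orbit c zero    = h (even c)
  orbit c (suc n) = h (suc (orbit c n))

  orbit-recursive : Recursive₁ h → Recursive₂ orbit
  orbit-recursive c = primRec₂ (λ _ _ k → h (suc k)) (c ∙ᶠ even-recursive)
    (ternary (subst₁ c (subst₁ suc-recursive arg₂))) (λ _ → refl) (λ _ _ → refl)

  -- `Iterate` counts from 1 and `orbit` from 0. Past the exit `orbit` goes on with meaningless
  -- values, so the claim covers existing iterates only.
  orbit-iterate : ∀ {x n z} → Iterate {⟦ X ⟧} {⟦ U ⟧} {⟦ Y ⟧} f x (suc n) z →
                  orbit (code X x) n ≡ code (U ⊕ Y) z
  orbit-iterate {x} first = tracks (inj₁ x)
  orbit-iterate {x} {suc n} (again {u = u} i) = begin
    h (suc (orbit (code X x) n))     ≡⟨ cong (h ∘ suc) (orbit-iterate i) ⟩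
    h (suc (2 * code U u + 0))       ≡⟨ cong h (+-suc (2 * code U u) 0) ⟨
    h (odd (code U u))               ≡⟨ tracks (inj₂ u) ⟩
    code (U ⊕ Y) (f (inj₂ u))        ∎
    where open ≡-Reasoning

  -- An iterate that is followed by another lies in `U`, the even summand.
  orbit-even : ∀ {x n z} → Iterate {⟦ X ⟧} {⟦ U ⟧} {⟦ Y ⟧} f x (suc n) z →
               ∀ {k} → k < n → parity (orbit (code X x) k) ≡ 0
  orbit-even {x} {suc n} (again {u = u} i) k<n with m≤n⇒m<n∨m≡n (s≤s⁻¹ k<n)
  ... | inj₁ k<n′ = orbit-even i k<n′
  ... | inj₂ refl = trans (cong parity (orbit-iterate i)) (parity-even (code U u))

-- The number of rounds is never 0, so it can be shifted to the index of `orbit`.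
iterate-suc : {X U Y : Set} {f : X ⊎ U → U ⊎ Y} {x : X} {n : ℕ} {z : U ⊎ Y} →
  Iterate f x n z → ∃[ k ] Iterate f x (suc k) z
iterate-suc first     = _ , first
iterate-suc (again i) = _ , again i

computable⇒recursive : ∀ {X Y f} (F : ∅-Free X) (G : ∅-Free Y) → 𝔇N X Y f →
                       Recursive₁ (hat F G f)
computable⇒recursive {X} {Y} {g} F G (U , f , d , t , eq)
  with h , c , tracks ← derived⇒tracked d =
  resp₁ correct (half-recursive ∙ᶠ lift₂ (orbit-recursive c) (normalize-recursive F) time-recursive)
  where
  open Orbit X U Y f h tracks

  orbit′ : ℕ → ℕ → ℕ
  orbit′ m = orbit (code X (σ′ F m))

  test : Vec ℕ 2 → ℕ
  -- Zero exactly at odd values; up to and including the exit, these are the codes of elements of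
  -- `Y`.
  test v = 1 ∸ parity (orbit′ (lookup v zero) (lookup v (suc zero)))

  testᶠ : Recursive test
  testᶠ = subst₂ ∸-recursive (subst₁ suc-recursive zeroᶠ) (subst₁ parity-recursive
    (subst₂ (orbit-recursive c) (subst₁ (normalize-recursive F) arg₀) arg₁))

  result : ∀ m → ∃[ n ] Iterate {⟦ X ⟧} {⟦ U ⟧} {⟦ Y ⟧} f (σ′ F m) (suc n) (inj₂ (g (σ′ F m)))
  result m = let n , i = iterate-suc (proj₂ (proj₂ (t (σ′ F m)))) in
    n , subst (Iterate f (σ′ F m) (suc n) ∘ inj₂) (sym (eq (σ′ F m))) i

  -- The termination proof supplies the number but not its recursiveness; that comes from `least`.
  time : ℕ → ℕ
  time m = proj₁ (result m)

  orbit-time : ∀ m → orbit′ m (time m) ≡ odd (code Y (g (σ′ F m)))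
  orbit-time m = orbit-iterate (proj₂ (result m))

  least : ∀ (v : Vec ℕ 1) → IsLeast (λ n → test (v ∷ʳ n) ≡ 0) (time (lookup v zero))
  least (m ∷ []) =
    cong (1 ∸_) (trans (cong parity (orbit-time m)) (parity-odd (code Y (g (σ′ F m))))) ,
    -- Before the exit the parity is 0, so the test gives 1.
    λ k e → ≮⇒≥ λ k<n →
      1+n≢0 (trans (cong (1 ∸_) (sym (orbit-even (proj₂ (result m)) k<n))) e)

  time-recursive : Recursive₁ time
  time-recursive = unary (minimize testᶠ (λ v → _ , proj₁ (least v)) least)

  correct : ∀ m → half (orbit′ m (time m)) ≡ hat F G g m
  correct m = trans (cong half (orbit-time m)) (trans (half-odd _) (code-σ G (g (σ′ F m))))

𝓖⊆𝓕 : ∀ {h} → 𝓖 h → 𝓕 h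
𝓖⊆𝓕 (X , Y , F , G , f , c , eq) =
  resp (λ { (n ∷ []) → sym (eq n) }) (recursive₁ (computable⇒recursive F G c))

theorem4 : 𝓕 ≐ 𝓖
theorem4 = 𝓕⊆𝓖 , 𝓖⊆𝓕
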